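{- Let $n\ge 3$ be an integer and let $G$ be a simple graph. Then $G$ is isomorphic to the cycle $C_n$ on $n$ vertices if and only if $$da(G;x,y) = nxy^{n-2} + ny^{n}\sum_{i=2}^{n-1}x^{i} + x^{n}y^{n+2}.$$
   Context: All graphs are finite, simple and have at least one vertex. For a graph $G$, $S\subseteq V(G)$ and $u\in V(G)$, let $\bar S=V(G)\setminus S$, let $\delta_S(u)=|\{v\in S:\{u,v\}\in E(G)\}|$, and let $G[S]$ be the subgraph induced by $S$. The defensive alliance polynomial of $G$ is $$da(G;x,y)=\sum_{S} x^{|S|}\,y^{f_y(S)},\qquad f_y(S)=\min_{u\in S}\bigl(\delta_S(u)-\delta_{\bar S}(u)+|V(G)|\bigr),$$ where the sum runs over all non-empty $S\subseteq V(G)$ such that $G[S]$ is connected (single-vertex graphs are connected). -}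

module Defs where

open import Data.Bool using (if_then_else_; _∧_)
open import Data.Fin using (Fin; toℕ)
import Data.Fin.Properties as Fin
open import Data.Fin.Subset
  using (Subset; inside; outside; _∈_; _∩_; ∁; ∣_∣; Nonempty)
open import Data.Fin.Subset.Properties using (_∈?_; nonempty?)
open import Data.List
  using (List; []; _∷_; _++_; [_]; map; foldr; filter; allFin; upTo;
         cartesianProductWith)
open import Data.List.Extrema.Nat using (min)
open import Data.List.Membership.Propositional using () renaming (_∈_ to _∈ᴸ_)
open import Data.List.Membership.Propositional.Properties using (∈-allFin)
open import Data.List.Relation.Unary.Any using (here; there)
open import Data.Nat using (ℕ; zero; suc; _+_; _*_; _∸_; _≤_; s≤s; _≟_)
open import Data.Nat.ListAction using (sum)
open import Data.Nat.Properties using (1+n≢n)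
open import Data.Product using (Σ; _×_; _,_)
open import Data.Sum using (_⊎_; inj₁; inj₂; swap)
open import Data.Vec using ([]; _∷_; tabulate)
open import Function.Bundles using (_↔_; _⇔_; Inverse)
open import Level using (0ℓ)
open import Relation.Binary
  using (Rel; Decidable; Symmetric; Irreflexive)
open import Relation.Binary.Construct.Closure.ReflexiveTransitive
  using (Star; ε; _◅_; _◅◅_)
open import Relation.Binary.PropositionalEquality using (_≡_; refl)
open import Relation.Nullary
  using (Dec; yes; no; does; _×-dec_; _⊎-dec_; _→-dec_; map′)

-- A formal sum of terms c xⁱ yʲ, each stored as (c , i , j).  Terms may be
-- repeated or have c = 0; equality of polynomials is _≈ₚ_ below.
Poly : Set
Poly = List (ℕ × ℕ × ℕ)

coeff : Poly → ℕ → ℕ → ℕ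
coeff p i j =
  sum (map (λ (c , a , b) → if does (a ≟ i) ∧ does (b ≟ j) then c else 0) p)

infix 4 _≈ₚ_
_≈ₚ_ : Poly → Poly → Set
p ≈ₚ q = ∀ i j → coeff p i j ≡ coeff q i j

const : ℕ → Poly
const c = [ (c , 0 , 0) ]

x y : Poly
x = [ (1 , 1 , 0) ]
y = [ (1 , 0 , 1) ]

infixl 6 _+ₚ_
_+ₚ_ : Poly → Poly → Poly
_+ₚ_ = _++_

infixl 7 _*ₚ_
_*ₚ_ : Poly → Poly → Poly
_*ₚ_ = cartesianProductWith
  (λ (c , a , b) (c′ , a′ , b′) → (c * c′ , a + a′ , b + b′))

infixr 8 _^ₚ_
_^ₚ_ : Poly → ℕ → Poly
p ^ₚ zero  = const 1
p ^ₚ suc k = p *ₚ p ^ₚ k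

sumₚ : List Poly → Poly
sumₚ = foldr _+ₚ_ (const 0)

-- ∑ᵢ₌ₐᵇ f i, empty when b < a.
∑[_⋯_] : ℕ → ℕ → (ℕ → Poly) → Poly
∑[ a ⋯ b ] f = sumₚ (map (λ k → f (a + k)) (upTo (suc b ∸ a)))

record Graph (n : ℕ) : Set₁ where
  field
    Adj        : Rel (Fin n) 0ℓ
    adj?       : Decidable Adj
    adj-sym    : Symmetric Adj
    adj-irrefl : Irreflexive _≡_ Adj

infix 4 _≅_
_≅_ : ∀ {m n} → Graph m → Graph n → Set
_≅_ {m} {n} G H =
  Σ (Fin m ↔ Fin n) λ f →
    ∀ u v → Graph.Adj G u v ⇔ Graph.Adj H (Inverse.to f u) (Inverse.to f v)

-- v follows u in the cyclic order 0, 1, …, n - 1, 0.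
Next : ∀ {n} → Rel (Fin n) 0ℓ
Next {n} u v =
  suc (toℕ u) ≡ toℕ v ⊎ (suc (toℕ u) ≡ n × toℕ v ≡ 0)

cycle : ∀ n → 3 ≤ n → Graph n
cycle n 3≤n = record
  { Adj        = λ u v → Next u v ⊎ Next v u
  ; adj?       = λ u v → next? u v ⊎-dec next? v u
  ; adj-sym    = swap
  ; adj-irrefl = λ { refl (inj₁ p) → irr 3≤n p ; refl (inj₂ p) → irr 3≤n p }
  }
  where
  open import Data.Empty using (⊥)

  next? : Decidable (Next {n})
  next? u v = (suc (toℕ u) ≟ toℕ v)
    ⊎-dec ((suc (toℕ u) ≟ n) ×-dec (toℕ v ≟ 0))

  irr : ∀ {n} {u : Fin n} → 3 ≤ n → Next u u → ⊥
  irr _ (inj₁ p) = 1+n≢n p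
  irr h (inj₂ (p , q)) rewrite q with p | h
  ... | refl | s≤s ()

-- Floyd–Warshall: Reach ws u v is reachability from u to v along R with all
-- intermediate vertices taken from ws.
module Reachability {n : ℕ} {R : Rel (Fin n) 0ℓ} (R? : Decidable R) where

  Reach : List (Fin n) → Rel (Fin n) 0ℓ
  Reach []       u v = u ≡ v ⊎ R u v
  Reach (w ∷ ws) u v = Reach ws u v ⊎ (Reach ws u w × Reach ws w v)

  reach? : ∀ ws → Decidable (Reach ws)
  reach? []       u v = (u Fin.≟ v) ⊎-dec R? u v
  reach? (w ∷ ws) u v =
    reach? ws u v ⊎-dec (reach? ws u w ×-dec reach? ws w v)

  base : ∀ ws {u v} → u ≡ v ⊎ R u v → Reach ws u v
  base []       p = p
  base (w ∷ ws) p = inj₁ (base ws p)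

  sound : ∀ ws {u v} → Reach ws u v → Star R u v
  sound []       (inj₁ refl)    = ε
  sound []       (inj₂ r)       = r ◅ ε
  sound (w ∷ ws) (inj₁ p)       = sound ws p
  sound (w ∷ ws) (inj₂ (p , q)) = sound ws p ◅◅ sound ws q

  join : ∀ ws {u v w} → w ∈ᴸ ws → Reach ws u w → Reach ws w v → Reach ws u v
  join (k ∷ ws) {u} {v} (here refl) p q = inj₂ (upto p , from q)
    where
    upto : Reach (k ∷ ws) u k → Reach ws u k
    upto (inj₁ p)       = p
    upto (inj₂ (p , _)) = p
    from : Reach (k ∷ ws) k v → Reach ws k v
    from (inj₁ q)       = q
    from (inj₂ (_ , q)) = q
  join (k ∷ ws) (there i) (inj₁ p)       (inj₁ q)       = inj₁ (join ws i p q)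
  join (k ∷ ws) (there i) (inj₁ p)       (inj₂ (q , r)) = inj₂ (join ws i p q , r)
  join (k ∷ ws) (there i) (inj₂ (p , q)) (inj₁ r)       = inj₂ (p , join ws i q r)
  join (k ∷ ws) (there i) (inj₂ (p , _)) (inj₂ (_ , r)) = inj₂ (p , r)

  complete : ∀ {u v} → Star R u v → Reach (allFin n) u v
  complete ε = base (allFin n) (inj₁ refl)
  complete (_◅_ {j = w} r rs) =
    join (allFin n) (∈-allFin w) (base (allFin n) (inj₂ r)) (complete rs)

  star? : Decidable (Star R)
  star? u v = map′ (sound (allFin n)) complete (reach? (allFin n) u v)

subsets : ∀ n → List (Subset n)
subsets zero    = [ [] ]
subsets (suc n) = map (inside ∷_) (subsets n) ++ map (outside ∷_) (subsets n)

module _ {n : ℕ} (G : Graph n) where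
  open Graph G

  neighbours : Fin n → Subset n
  neighbours u = tabulate (λ v → does (adj? u v))

  δ : Subset n → Fin n → ℕ
  δ S u = ∣ S ∩ neighbours u ∣

  InducedAdj : Subset n → Rel (Fin n) 0ℓ
  InducedAdj S u v = u ∈ S × v ∈ S × Adj u v

  -- G[S] is connected: any two vertices of S are joined by a walk in G[S].
  Connected : Subset n → Set
  Connected S = ∀ u v → u ∈ S → v ∈ S → Star (InducedAdj S) u v

  connected? : ∀ S → Dec (Connected S)
  connected? S = Fin.all? λ u → Fin.all? λ v →
    (u ∈? S) →-dec ((v ∈? S) →-dec star? u v)
    where
    open Reachability {R = InducedAdj S}
      (λ u v → (u ∈? S) ×-dec ((v ∈? S) ×-dec adj? u v))

  -- The truncated subtraction is exact: a vertex has at most n - 1 neighbours.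
  strength : Subset n → Fin n → ℕ
  strength S u = (δ S u + n) ∸ δ (∁ S) u

  -- min takes a starting value besides the list; the strength of the given
  -- element u₀ of S is itself one of the listed values.
  f-y : (S : Subset n) → Nonempty S → ℕ
  f-y S (u₀ , _) =
    min (strength S u₀) (map (strength S) (filter (_∈? S) (allFin n)))

  term : Subset n → Poly
  term S with nonempty? S ×-dec connected? S
  ... | yes (ne , _) = x ^ₚ ∣ S ∣ *ₚ y ^ₚ f-y S ne
  ... | no  _        = const 0

  da : Poly
  da = sumₚ (map term (subsets n))

{-# OPTIONS --safe #-}

-- In a cycle the connected vertex sets are the whole vertex set and the proper arcs,
-- a proper arc being determined by its first vertex and its size.  All degrees are 2,
-- so a vertex u of S has strength n - 2 + 2 δ_S(u): this is n - 2 for a single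
-- vertex, n at the ends of a longer proper arc, and n + 2 in the whole cycle.
-- Conversely, the coefficients of x count the vertices and show that all degrees
-- are 2, while the non-zero coefficient of xⁿ yⁿ⁺² shows that G is connected.  In
-- a connected 2-regular graph a walk that never turns back first repeats a vertex
-- by returning to its start, and then it has traversed all of G.

module Submission where

open import Defs
open import Data.Empty using () renaming (⊥ to Empty)
open import Data.Bool using (Bool; true; false; if_then_else_; _∧_; not)
open import Data.Bool.Properties using (T-≡; ¬-not)
open import Data.Fin using (Fin; zero; suc; toℕ; fromℕ<; punchOut)
import Data.Fin.Properties as Fin
open import Data.Fin.Subset
  using (Subset; inside; outside; _∈_; _∉_; _∩_; _∪_; ∁; ⊤; ⊥; ⁅_⁆; ∣_∣; Nonempty)
open import Data.Fin.Subset.Properties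
open import Data.List
  using (List; []; _∷_; _++_; [_]; map; filter; length; allFin; upTo; applyUpTo;
         tabulate; cartesianProductWith)
open import Data.List.Extrema.Nat using (min≤v⁺; v≤min⁺)
open import Data.List.Membership.Propositional using (lose) renaming (_∈_ to _∈ᴸ_)
open import Data.List.Membership.Propositional.Properties
  using (∈-map⁺; ∈-map⁻; ∈-++⁺ˡ; ∈-++⁺ʳ; ∈-filter⁺; ∈-filter⁻; ∈-allFin;
         ∈-cartesianProductWith⁺; ∈-cartesianProductWith⁻)
open import Data.List.Membership.Propositional.Properties.WithK
  using (unique∧set⇒bag)
open import Data.List.Properties
  using (map-++; map-∘; map-applyUpTo; filter-accept; filter-reject; length-tabulate)
open import Data.List.Relation.Binary.BagAndSetEquality using (∼bag⇒↭)
open import Data.List.Relation.Binary.Permutation.Propositional.Properties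
  using () renaming (map⁺ to ↭-map⁺)
import Data.List.Relation.Unary.All as All
import Data.List.Relation.Unary.All.Properties as All
open import Data.List.Relation.Unary.AllPairs using ([]; _∷_)
open import Data.List.Relation.Unary.Any using (here; there)
import Data.List.Relation.Unary.Unique.Propositional.Properties as Unique
open import Data.List.Relation.Unary.Unique.Propositional using (Unique)
open import Data.Nat
  using (ℕ; zero; suc; _+_; _*_; _∸_; _≤_; _<_; z≤n; s≤s; _≟_; _≡ᵇ_; NonZero; s≤s⁻¹)
open import Data.Nat.GeneralisedArithmetic using (fold; fold-+)
open import Data.Nat.ListAction using (sum)
open import Data.Nat.ListAction.Properties using (sum-++; sum-↭)
open import Data.Nat.Properties
open import Data.Product using (∃; ∃₂; _×_; _,_; proj₁; proj₂)
open import Data.Sum using (_⊎_; inj₁; inj₂; swap) renaming (map to map-⊎)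
open import Data.Vec using ([]; _∷_; lookup; here; there)
open import Data.Vec.Properties
  using ([]=⇒lookup; lookup⇒[]=; lookup∘tabulate; lookup-map; lookup-replicate;
         ∷-injectiveʳ)
open import Function using (_∘_; _$_)
open import Function.Bundles using (_⇔_; mk⇔; mk↔ₛ′; Equivalence; Injection; Inverse)
open import Function.Properties.Inverse using (↔⇒↣; ↔-sym)
open import Relation.Binary.Construct.Closure.ReflexiveTransitive
  using (Star; ε; _◅_; _◅◅_; reverse)
open import Relation.Binary.Definitions using (tri<; tri≈; tri>)
open import Relation.Binary.PropositionalEquality hiding ([_])
open import Relation.Nullary
  using (¬_; Dec; yes; no; does; contradiction; ¬?; _×-dec_)
open import Relation.Nullary.Decidable using (dec-true; decidable-stable)

private
  variable
    A B C : Set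

-- Sums over lists

sum-map-cong : {g h : A → ℕ} → (∀ a → g a ≡ h a) → ∀ xs → sum (map g xs) ≡ sum (map h xs)
sum-map-cong eq []       = refl
sum-map-cong eq (a ∷ as) = cong₂ _+_ (eq a) (sum-map-cong eq as)

sum-map-const : {g : A → ℕ} {c : ℕ} → (∀ a → g a ≡ c) → ∀ xs → sum (map g xs) ≡ length xs * c
sum-map-const eq []       = refl
sum-map-const eq (a ∷ as) = cong₂ _+_ (eq a) (sum-map-const eq as)

sum-map-≢0 : (g : A → ℕ) (xs : List A) → sum (map g xs) ≢ 0 → ∃ λ a → g a ≢ 0
sum-map-≢0 g []       s≢0 = contradiction refl s≢0
sum-map-≢0 g (a ∷ as) s≢0 with g a ≟ 0
... | yes ga≡0 = sum-map-≢0 g as (s≢0 ∘ trans (cong (_+ sum (map g as)) ga≡0))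
... | no  ga≢0 = a , ga≢0

sum-map-≥ : (g : A → ℕ) {xs : List A} {a : A} → a ∈ᴸ xs → g a ≤ sum (map g xs)
sum-map-≥ g (here refl)       = m≤m+n _ _
sum-map-≥ g (there {x = b} i) = ≤-trans (sum-map-≥ g i) (m≤n+m _ (g b))

-- `allFin` and `upTo` both tabulate the identity; arbitrary `p` and `q` are taken because the
-- induction step composes them with `suc`.
sum-map-applyUpTo : (h : B → ℕ) (g : C → ℕ) (p : ℕ → B) {m : ℕ} (q : Fin m → C) →
  (∀ k → g (q k) ≡ h (p (toℕ k))) → sum (map g (tabulate q)) ≡ sum (map h (applyUpTo p m))
sum-map-applyUpTo h g p {zero}  q eq = refl
sum-map-applyUpTo h g p {suc m} q eq =
  cong₂ _+_ (eq zero) (sum-map-applyUpTo h g (p ∘ suc) (q ∘ suc) (eq ∘ suc))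

-- The entries of one row contribute equally. In the application a row holds the arcs of one size,
-- one for each first vertex.
sum-map-cartesianProductWith : (f : A → B → C) (g : C → ℕ) (h : A → ℕ) →
  (∀ a b → g (f a b) ≡ h a) → ∀ as bs →
  sum (map g (cartesianProductWith f as bs)) ≡ sum (map (λ a → length bs * h a) as)
sum-map-cartesianProductWith f g h eq []       bs = refl
sum-map-cartesianProductWith f g h eq (a ∷ as) bs = begin
  sum (map g (map (f a) bs ++ cs))             ≡⟨ cong sum (map-++ g (map (f a) bs) cs) ⟩
  sum (map g (map (f a) bs) ++ map g cs)       ≡⟨ sum-++ (map g (map (f a) bs)) _ ⟩
  sum (map g (map (f a) bs)) + sum (map g cs)  ≡⟨ cong₂ _+_ (row bs)
                                                    (sum-map-cartesianProductWith f g h eq as bs) ⟩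
  length bs * h a + sum (map (λ a → length bs * h a) as) ∎
  where
  open ≡-Reasoning
  cs = cartesianProductWith f as bs
  row : ∀ bs → sum (map g (map (f a) bs)) ≡ length bs * h a
  row []       = refl
  row (b ∷ bs) = cong₂ _+_ (eq a b) (row bs)

-- Once the entries where `g` vanishes are dropped, both lists are repetition-free with the same
-- members, hence permutations of each other. This reduces sums over all subsets to sums over the
-- connected ones or the singletons.
sum-map-support : (g : A → ℕ) {xs ys : List A} → Unique xs → Unique ys →
  (∀ {a} → a ∈ᴸ xs → g a ≢ 0 → a ∈ᴸ ys) → (∀ {a} → a ∈ᴸ ys → a ∈ᴸ xs) →
  sum (map g xs) ≡ sum (map g ys)
sum-map-support {A} g {xs} {ys} xs! ys! ⊆ys ys⊆ = begin
  sum (map g xs)           ≡⟨ drop-zeros xs ⟨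
  sum (map g (support xs)) ≡⟨ sum-↭ (↭-map⁺ g (∼bag⇒↭
                                (unique∧set⇒bag (Unique.filter⁺ g≢0? xs!) (Unique.filter⁺ g≢0? ys!)
                                  (mk⇔ to from)))) ⟩
  sum (map g (support ys)) ≡⟨ drop-zeros ys ⟩
  sum (map g ys)           ∎
  where
  open ≡-Reasoning
  g≢0? : ∀ a → Dec (g a ≢ 0)
  g≢0? a = ¬? (g a ≟ 0)
  support : List A → List A
  support = filter g≢0?
  drop-zeros : ∀ zs → sum (map g (support zs)) ≡ sum (map g zs)
  drop-zeros []       = refl
  drop-zeros (z ∷ zs) with g z ≟ 0
  ... | yes gz≡0 = begin
    sum (map g (support (z ∷ zs))) ≡⟨ cong (sum ∘ map g) (filter-reject g≢0? (_$ gz≡0)) ⟩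
    sum (map g (support zs))       ≡⟨ drop-zeros zs ⟩
    sum (map g zs)                 ≡⟨ cong (_+ sum (map g zs)) gz≡0 ⟨
    g z + sum (map g zs)           ∎
  ... | no gz≢0 = begin
    sum (map g (support (z ∷ zs))) ≡⟨ cong (sum ∘ map g) (filter-accept g≢0? gz≢0) ⟩
    g z + sum (map g (support zs)) ≡⟨ cong (g z +_) (drop-zeros zs) ⟩
    g z + sum (map g zs)           ∎
  to : ∀ {a} → a ∈ᴸ support xs → a ∈ᴸ support ys
  to i with j , ga≢0 ← ∈-filter⁻ g≢0? {xs = xs} i = ∈-filter⁺ g≢0? (⊆ys j ga≢0) ga≢0
  from : ∀ {a} → a ∈ᴸ support ys → a ∈ᴸ support xs
  from i with j , ga≢0 ← ∈-filter⁻ g≢0? {xs = ys} i = ∈-filter⁺ g≢0? (ys⊆ j) ga≢0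

-- Coefficients of the cycle formula

-- The coefficient of xⁱ yʲ in c xᵃ yᵇ, in the form to which `coeff` unfolds.
mono : ℕ → ℕ → ℕ → ℕ → ℕ → ℕ
mono c a b i j = if does (a ≟ i) ∧ does (b ≟ j) then c else 0

mono-zero : ∀ a b i j → mono 0 a b i j ≡ 0
mono-zero a b i j with does (a ≟ i) ∧ does (b ≟ j)
... | true  = refl
... | false = refl

*-mono : ∀ c a b i j → c * mono 1 a b i j ≡ mono c a b i j
*-mono c a b i j with does (a ≟ i) ∧ does (b ≟ j)
... | true  = *-identityʳ c
... | false = *-zeroʳ c

mono-self : ∀ c a b → mono c a b a b ≡ c
mono-self c a b rewrite dec-true (a ≟ a) refl | dec-true (b ≟ b) refl = refl

mono-≢0 : ∀ c a b i j → mono c a b i j ≢ 0 → a ≡ i × b ≡ j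
-- `does (a ≟ i)` computes to `a ≡ᵇ i`, so matching on the Boolean tests evaluates the conditional.
mono-≢0 c a b i j ≢0 with a ≡ᵇ i in p | b ≡ᵇ j in q
... | true  | true  = ≡ᵇ⇒≡ a i (Equivalence.from T-≡ p) , ≡ᵇ⇒≡ b j (Equivalence.from T-≡ q)
... | true  | false = contradiction refl ≢0
... | false | _     = contradiction refl ≢0

coeff-++ : ∀ p q i j → coeff (p ++ q) i j ≡ coeff p i j + coeff q i j
coeff-++ []                q i j = refl
coeff-++ ((c , a , b) ∷ p) q i j =
  trans (cong (mono c a b i j +_) (coeff-++ p q i j)) (sym (+-assoc (mono c a b i j) _ _))

coeff-monomial : ∀ c a b i j → coeff [ (c , a , b) ] i j ≡ mono c a b i j
coeff-monomial c a b i j = +-identityʳ _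

coeff-zero : ∀ i j → coeff (const 0) i j ≡ 0
coeff-zero i j = trans (coeff-monomial 0 0 0 i j) (mono-zero 0 0 i j)

coeff-sumₚ : ∀ ps i j → coeff (sumₚ ps) i j ≡ sum (map (λ p → coeff p i j) ps)
coeff-sumₚ []       i j = coeff-zero i j
coeff-sumₚ (p ∷ ps) i j =
  trans (coeff-++ p (sumₚ ps) i j) (cong (coeff p i j +_) (coeff-sumₚ ps i j))

x^-monomial : ∀ k → x ^ₚ k ≡ [ (1 , k , 0) ]
x^-monomial zero    = refl
x^-monomial (suc k) rewrite x^-monomial k = refl

y^-monomial : ∀ k → y ^ₚ k ≡ [ (1 , 0 , k) ]
y^-monomial zero    = refl
y^-monomial (suc k) rewrite y^-monomial k = refl

coeff-monomial-*-sumₚ : ∀ c b (g : ℕ → ℕ) ks i j →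
  coeff ([ (c , 0 , b) ] *ₚ sumₚ (map (λ k → x ^ₚ g k) ks)) i j ≡
  sum (map (λ k → mono c (g k) b i j) ks)
-- The empty `sumₚ` is `const 0` rather than the empty list, so one term with coefficient `c * 0`
-- remains.
coeff-monomial-*-sumₚ c b g []       i j rewrite *-zeroʳ c | mono-zero 0 (b + 0) i j = refl
coeff-monomial-*-sumₚ c b g (k ∷ ks) i j
  rewrite x^-monomial (g k) | *-identityʳ c | +-identityʳ b =
  cong (mono c (g k) b i j +_) (coeff-monomial-*-sumₚ c b g ks i j)

cycleFormula : ℕ → Poly
cycleFormula n =
  const n *ₚ x *ₚ y ^ₚ (n ∸ 2)
  +ₚ const n *ₚ y ^ₚ n *ₚ ∑[ 2 ⋯ n ∸ 1 ] (λ i → x ^ₚ i)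
  +ₚ x ^ₚ n *ₚ y ^ₚ (n + 2)

coeff-cycleFormula : ∀ n i j → 2 ≤ n → coeff (cycleFormula n) i j ≡
  mono n 1 (n ∸ 2) i j + sum (map (λ k → mono n (2 + k) n i j) (upTo (n ∸ 2))) + mono 1 n (n + 2) i j
-- With n written as 2 + n′ the summation range reduces to `upTo n′`.
coeff-cycleFormula n@(suc (suc n′)) i j (s≤s (s≤s z≤n))
  = trans (coeff-++ (p₁ +ₚ p₂) (x ^ₚ n *ₚ y ^ₚ (n + 2)) i j)
      (cong₂ _+_ (trans (coeff-++ p₁ p₂ i j) (cong₂ _+_ linear middle)) top)
  where
  p₁ = const n *ₚ x *ₚ y ^ₚ n′
  p₂ = const n *ₚ y ^ₚ n *ₚ ∑[ 2 ⋯ n ∸ 1 ] (λ i → x ^ₚ i)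
  linear : coeff p₁ i j ≡ mono n 1 n′ i j
  linear rewrite y^-monomial n′ | *-identityʳ n′ | *-identityʳ n′ = +-identityʳ _
  middle : coeff p₂ i j ≡ sum (map (λ k → mono n (2 + k) n i j) (upTo n′))
  middle rewrite y^-monomial n | *-identityʳ n′ = coeff-monomial-*-sumₚ n n (2 +_) (upTo n′) i j
  top : coeff (x ^ₚ n *ₚ y ^ₚ (n + 2)) i j ≡ mono 1 n (n + 2) i j
  top rewrite x^-monomial n | y^-monomial (n + 2) | +-identityʳ n′ = +-identityʳ _

-- Finite subsets and their cardinalities

∈-subsets : ∀ {n} (S : Subset n) → S ∈ᴸ subsets n
∈-subsets []            = here refl
∈-subsets (inside  ∷ S) = ∈-++⁺ˡ (∈-map⁺ (inside ∷_) (∈-subsets S))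
∈-subsets {suc n} (outside ∷ S) = ∈-++⁺ʳ (map (inside ∷_) (subsets n)) (∈-map⁺ (outside ∷_) (∈-subsets S))

subsets-unique : ∀ n → Unique (subsets n)
subsets-unique zero    = All.[] ∷ []
subsets-unique (suc n) =
  Unique.++⁺ (Unique.map⁺ ∷-injectiveʳ (subsets-unique n)) (Unique.map⁺ ∷-injectiveʳ (subsets-unique n))
    λ (i , o) → in≢out (∈-map⁻ _ i) (∈-map⁻ _ o)
  where
  in≢out : ∀ {S : Subset (suc n)} → (∃ λ p → p ∈ᴸ subsets n × S ≡ inside ∷ p) →
           (∃ λ p → p ∈ᴸ subsets n × S ≡ outside ∷ p) → Empty
  in≢out (_ , _ , refl) (_ , _ , ())

[_]₁ : Bool → ℕ
[ b ]₁ = if b then 1 else 0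

lookup-∉ : ∀ {n} {u : Fin n} {S : Subset n} → u ∉ S → lookup S u ≡ false
lookup-∉ {u = u} {S} u∉S = ¬-not (u∉S ∘ lookup⇒[]= u S)

-- Recursion along the vectors to the position of `a`. Keeping `S` arbitrary lets one count serve
-- both for cardinalities, at `S = ⊤`, and for the neighbours of a vertex inside `S`.
∣∩⁅⁆∪∣ : ∀ {n} (S : Subset n) {a : Fin n} {p : Subset n} → a ∉ p →
  ∣ S ∩ (⁅ a ⁆ ∪ p) ∣ ≡ [ lookup S a ]₁ + ∣ S ∩ p ∣
∣∩⁅⁆∪∣ (s ∷ S)       {zero}  {true  ∷ p} a∉p = contradiction here a∉p
∣∩⁅⁆∪∣ (true  ∷ S) {zero}  {false ∷ p} a∉p = cong (λ q → suc ∣ S ∩ q ∣) (∪-identityˡ p)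
∣∩⁅⁆∪∣ (false ∷ S) {zero}  {false ∷ p} a∉p = cong (λ q → ∣ S ∩ q ∣) (∪-identityˡ p)
∣∩⁅⁆∪∣ (false ∷ S) {suc a} {t ∷ p}     a∉p = ∣∩⁅⁆∪∣ S (a∉p ∘ there)
∣∩⁅⁆∪∣ (true  ∷ S) {suc a} {false ∷ p} a∉p = ∣∩⁅⁆∪∣ S (a∉p ∘ there)
∣∩⁅⁆∪∣ (true  ∷ S) {suc a} {true  ∷ p} a∉p =
  trans (cong suc (∣∩⁅⁆∪∣ S (a∉p ∘ there))) (sym (+-suc _ _))

∣∩⁅⁆∣ : ∀ {n} (S : Subset n) (a : Fin n) → ∣ S ∩ ⁅ a ⁆ ∣ ≡ [ lookup S a ]₁
∣∩⁅⁆∣ {n} S a = begin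
  ∣ S ∩ ⁅ a ⁆ ∣               ≡⟨ cong (λ p → ∣ S ∩ p ∣) (∪-identityʳ ⁅ a ⁆) ⟨
  ∣ S ∩ (⁅ a ⁆ ∪ ⊥) ∣         ≡⟨ ∣∩⁅⁆∪∣ S ∉⊥ ⟩
  [ lookup S a ]₁ + ∣ S ∩ ⊥ ∣ ≡⟨ cong (λ p → [ lookup S a ]₁ + ∣ p ∣) (∩-zeroʳ S) ⟩
  [ lookup S a ]₁ + ∣ ⊥ {n} ∣ ≡⟨ cong ([ lookup S a ]₁ +_) (∣⊥∣≡0 n) ⟩
  [ lookup S a ]₁ + 0         ≡⟨ +-identityʳ _ ⟩
  [ lookup S a ]₁             ∎
  where open ≡-Reasoning

∣⁅⁆∪∣ : ∀ {n} {a : Fin n} {p : Subset n} → a ∉ p → ∣ ⁅ a ⁆ ∪ p ∣ ≡ suc ∣ p ∣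
∣⁅⁆∪∣ {n} {a} {p} a∉p = begin
  ∣ ⁅ a ⁆ ∪ p ∣                 ≡⟨ cong ∣_∣ (∩-identityˡ (⁅ a ⁆ ∪ p)) ⟨
  ∣ ⊤ ∩ (⁅ a ⁆ ∪ p) ∣           ≡⟨ ∣∩⁅⁆∪∣ ⊤ a∉p ⟩
  [ lookup ⊤ a ]₁ + ∣ ⊤ ∩ p ∣ ≡⟨ cong₂ (λ b q → [ b ]₁ + ∣ q ∣) (lookup-replicate a true) (∩-identityˡ p) ⟩
  suc ∣ p ∣                     ∎
  where open ≡-Reasoning

∣p∣≡0⇒∉ : ∀ {n} {p : Subset n} → ∣ p ∣ ≡ 0 → ∀ {u} → u ∉ p
∣p∣≡0⇒∉ {p = p} ∣p∣≡0 {u} u∈p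
  = contradiction (subst₂ _≤_ (∣⁅x⁆∣≡1 u) ∣p∣≡0 (p⊆q⇒∣p∣≤∣q∣ ⁅u⁆⊆p)) λ ()
  where
  ⁅u⁆⊆p : ∀ {w} → w ∈ ⁅ u ⁆ → w ∈ p
  ⁅u⁆⊆p w∈ rewrite x∈⁅y⁆⇒x≡y u w∈ = u∈p

decompose : ∀ {n k} (p : Subset n) → ∣ p ∣ ≡ suc k →
  ∃₂ λ a q → a ∉ q × p ≡ ⁅ a ⁆ ∪ q × ∣ q ∣ ≡ k
decompose (true  ∷ p) ∣p∣≡ =
  zero , outside ∷ p , (λ ()) , cong (inside ∷_) (sym (∪-identityˡ p)) , suc-injective ∣p∣≡
decompose (false ∷ p) ∣p∣≡ with a , q , a∉q , refl , ∣q∣≡k ← decompose p ∣p∣≡ =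
  suc a , outside ∷ q , (λ { (there a∈q) → a∉q a∈q }) , refl , ∣q∣≡k

∣p∣≡1⇒singleton : ∀ {n} (p : Subset n) → ∣ p ∣ ≡ 1 → ∃ λ a → p ≡ ⁅ a ⁆
∣p∣≡1⇒singleton p ∣p∣≡1 with a , q , _ , refl , ∣q∣≡0 ← decompose p ∣p∣≡1 =
  a , trans (cong (⁅ a ⁆ ∪_) (Empty-unique λ (_ , i) → ∣p∣≡0⇒∉ ∣q∣≡0 i)) (∪-identityʳ ⁅ a ⁆)

∣p∣≡2⇒pair : ∀ {n} (p : Subset n) → ∣ p ∣ ≡ 2 → ∃₂ λ a b → a ≢ b × p ≡ ⁅ a ⁆ ∪ ⁅ b ⁆
∣p∣≡2⇒pair p ∣p∣≡2
  with a , q , a∉q , refl , ∣q∣≡1 ← decompose p ∣p∣≡2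
  with b , refl ← ∣p∣≡1⇒singleton q ∣q∣≡1 = a , b , x∉⁅y⁆⇒x≢y a∉q , refl

-- Terms of the defensive alliance polynomial

module _ {n : ℕ} (G : Graph n) where
  open Graph G

  ∈-neighbours : ∀ {u w} → w ∈ neighbours G u ⇔ Adj u w
  ∈-neighbours {u} {w} = mk⇔ to from
    where
    to : w ∈ neighbours G u → Adj u w
    to w∈ with adj? u w | trans (sym (lookup∘tabulate (λ v → does (adj? u v)) w)) ([]=⇒lookup w∈)
    ... | yes uw | _ = uw
    from : Adj u w → w ∈ neighbours G u
    from uw = lookup⇒[]= w _ (trans (lookup∘tabulate _ w) (dec-true (adj? u w) uw))

  -- A lower bound that is attained is the minimum; the starting value of `min` obeys the bound
  -- because `u₀` lies in `S`.
  f-y-≡ : ∀ {S e} → (∀ {u} → u ∈ S → e ≤ strength G S u) →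
    (∃ λ u → u ∈ S × strength G S u ≡ e) → ∀ ne → f-y G S ne ≡ e
  f-y-≡ {S} {e} e≤ (u , u∈S , refl) (u₀ , u₀∈S) = ≤-antisym
    (min≤v⁺ (strength G S u₀) strengths
      (inj₂ (lose (∈-map⁺ (strength G S) (∈-filter⁺ (_∈? S) (∈-allFin u) u∈S)) ≤-refl)))
    (v≤min⁺ (e≤ u₀∈S) (All.map⁺ (All.map e≤ (All.all-filter (_∈? S) (allFin n)))))
    where
    strengths = map (strength G S) (filter (_∈? S) (allFin n))

  x^*y^-monomial : ∀ a b → x ^ₚ a *ₚ y ^ₚ b ≡ [ (1 , a , b) ]
  x^*y^-monomial a b rewrite x^-monomial a | y^-monomial b | +-identityʳ a = refl

  -- The value of `f-y` is asked for at every witness `ne`, since `term` uses the one returned by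
  -- `nonempty?`.
  term-connected : ∀ {S e} → Nonempty S → Connected G S → (∀ ne → f-y G S ne ≡ e) →
    term G S ≡ [ (1 , ∣ S ∣ , e) ]
  term-connected {S} {e} ne conn f-y≡e with nonempty? S ×-dec connected? G S
  ... | yes (ne′ , _) = trans (x^*y^-monomial _ _) (cong (λ b → [ (1 , ∣ S ∣ , b) ]) (f-y≡e ne′))
  ... | no  ¬good     = contradiction (ne , conn) ¬good

  -- All other sets contribute the zero polynomial, and the exponent of x in a term is the size of
  -- its set.
  coeff-term-≢0 : ∀ {S} i j → coeff (term G S) i j ≢ 0 → Nonempty S × Connected G S × ∣ S ∣ ≡ i
  coeff-term-≢0 {S} i j ≢0 with nonempty? S ×-dec connected? G S
  ... | no  _ = contradiction (coeff-zero i j) ≢0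
  ... | yes (ne , conn)
    rewrite x^*y^-monomial ∣ S ∣ (f-y G S ne) =
    ne , conn ,
    proj₁ (mono-≢0 1 ∣ S ∣ (f-y G S ne) i j (≢0 ∘ trans (coeff-monomial 1 ∣ S ∣ (f-y G S ne) i j)))

  coeff-da : ∀ i j → coeff (da G) i j ≡ sum (map (λ S → coeff (term G S) i j) (subsets n))
  coeff-da i j = trans (coeff-sumₚ (map (term G) (subsets n)) i j) (cong sum (sym (map-∘ (subsets n))))

  Star-sym : ∀ {S u w} → Star (InducedAdj G S) u w → Star (InducedAdj G S) w u
  Star-sym = reverse λ (u∈S , w∈S , uw) → w∈S , u∈S , adj-sym uw

-- Arcs in graphs with a cyclic shift

least : (P : ℕ → Set) → (∀ k → Dec (P k)) → ∀ m → P m →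
  ∃ λ k → k ≤ m × P k × (∀ {l} → l < k → ¬ P l)
least P P? m Pm with search (suc m)
  where
  search : ∀ m → (∃ λ k → k < m × P k × (∀ {l} → l < k → ¬ P l)) ⊎ (∀ {l} → l < m → ¬ P l)
  search zero    = inj₂ λ ()
  search (suc m) with search m | P? m
  ... | inj₁ (k , k<m , found) | _      = inj₁ (k , m<n⇒m<1+n k<m , found)
  ... | inj₂ none              | yes Pm = inj₁ (m , ≤-refl , Pm , none)
  ... | inj₂ none              | no ¬Pm = inj₂ λ l≤m Pl → case-≤ (m≤n⇒m<n∨m≡n (s≤s⁻¹ l≤m)) Pl
    where
    case-≤ : ∀ {l} → l < m ⊎ l ≡ m → ¬ P l
    case-≤ (inj₁ l<m)  = none l<m
    case-≤ (inj₂ refl) = ¬Pm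
... | inj₁ (k , k<1+m , found) = k , s≤s⁻¹ k<1+m , found
... | inj₂ none                = contradiction Pm (none ≤-refl)

-- If `w` were missed, punching it out would inject `Fin m` into a set with one element fewer than
-- `Fin m` can fit into.
injective⇒surjective : ∀ {m n} {f : Fin m → Fin n} → n ≤ m →
  (∀ {i j} → f i ≡ f j → i ≡ j) → ∀ w → ∃ λ i → f i ≡ w
injective⇒surjective {m} {suc n} {f} n<m inj w with Fin.any? (λ i → f i Fin.≟ w)
... | yes found = found
... | no  none  = contradiction
  (Fin.injective⇒≤ {f = λ i → punchOut (w≢ i)} (inj ∘ Fin.punchOut-injective (w≢ _) (w≢ _)))
  (<⇒≱ n<m)
  where
  w≢ : ∀ i → w ≢ f i
  w≢ i w≡fi = none (i , sym w≡fi)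

-- `fold u σ k` is the `k`-th iterate of `σ` at `u`, with the last application outermost; this moves
-- the first application to the outside.
fold-suc : ∀ (σ : A → A) u k → fold (σ u) σ k ≡ fold u σ (suc k)
fold-suc σ u zero    = refl
fold-suc σ u (suc k) = cong σ (fold-suc σ u k)

fold-injective : ∀ {σ : A → A} → (∀ {u w} → σ u ≡ σ w → u ≡ w) →
  ∀ k {u w} → fold u σ k ≡ fold w σ k → u ≡ w
fold-injective σ-inj zero    eq = eq
fold-injective σ-inj (suc k) eq = fold-injective σ-inj k (σ-inj eq)

-- By free, every orbit of σ has at least, hence exactly, n elements.
record CyclicShift {n : ℕ} (G : Graph n) : Set where
  open Graph G
  field
    σ    : Fin n → Fin n
    adj  : ∀ u → Adj u (σ u)
    only : ∀ {u w} → Adj u w → w ≡ σ u ⊎ u ≡ σ w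
    inj  : ∀ {u w} → σ u ≡ σ w → u ≡ w
    free : ∀ u k → k < n → fold u σ k ≡ u → k ≡ 0

module Arcs {n : ℕ} (3≤n : 3 ≤ n) (G : Graph n) (shift : CyclicShift G) where
  open Graph G
  open CyclicShift shift

  -- Cancelling `k` steps leaves a return to `s` after `d = l - k` steps, and `d < n` forces `d` to
  -- be 0 by `free`.
  orbit-injective-≤ : ∀ s {k l} → k ≤ l → l < n → fold s σ k ≡ fold s σ l → k ≡ l
  orbit-injective-≤ s {k} k≤l l<n eq
    with d , refl ← m≤n⇒∃[o]m+o≡n k≤l
    with refl ← free s d (≤-<-trans (m≤n+m d k) l<n)
                  (fold-injective inj k (sym (trans eq (fold-+ s σ k)))) = sym (+-identityʳ k)

  orbit-injective : ∀ s {k l} → k < n → l < n → fold s σ k ≡ fold s σ l → k ≡ l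
  orbit-injective s {k} {l} k<n l<n eq with ≤-total k l
  ... | inj₁ k≤l = orbit-injective-≤ s k≤l l<n eq
  ... | inj₂ l≤k = sym (orbit-injective-≤ s l≤k k<n (sym eq))

  -- The first `n` iterates are distinct, so they exhaust the `n` vertices.
  reach : ∀ s w → ∃ λ k → k < n × fold s σ k ≡ w
  reach s w
    with i , eq ← injective⇒surjective {f = fold s σ ∘ toℕ} ≤-refl
                    (λ {i} {j} → Fin.toℕ-injective ∘ orbit-injective s (Fin.toℕ<n i) (Fin.toℕ<n j)) w
    = toℕ i , Fin.toℕ<n i , eq

  -- The inverse of `σ`: if `k` steps lead from `σ u` to `u`, then `k` steps from `u` end just
  -- before `u`.
  π : Fin n → Fin n
  π u = fold u σ (proj₁ (reach (σ u) u))

  σπ : ∀ u → σ (π u) ≡ u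
  σπ u = trans (sym (fold-suc σ u (proj₁ (reach (σ u) u)))) (proj₂ (proj₂ (reach (σ u) u)))

  -- Otherwise two steps would return to `u`, although 2 < n.
  σ≢π : ∀ u → σ u ≢ π u
  σ≢π u σu≡πu with () ← free u 2 3≤n (trans (cong σ σu≡πu) (σπ u))

  adj-π : ∀ u → Adj u (π u)
  adj-π u = adj-sym (subst (Adj (π u)) (σπ u) (adj (π u)))

  neighbours-pair : ∀ u → neighbours G u ≡ ⁅ σ u ⁆ ∪ ⁅ π u ⁆
  neighbours-pair u = ⊆-antisym to from
    where
    to : ∀ {w} → w ∈ neighbours G u → w ∈ ⁅ σ u ⁆ ∪ ⁅ π u ⁆
    to w∈ with only (Equivalence.to (∈-neighbours G) w∈)
    ... | inj₁ refl = x∈p∪q⁺ (inj₁ (x∈⁅x⁆ (σ u)))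
    ... | inj₂ u≡σw rewrite inj (trans (sym u≡σw) (sym (σπ u))) = x∈p∪q⁺ (inj₂ (x∈⁅x⁆ (π u)))
    from : ∀ {w} → w ∈ ⁅ σ u ⁆ ∪ ⁅ π u ⁆ → w ∈ neighbours G u
    from w∈ with x∈p∪q⁻ ⁅ σ u ⁆ ⁅ π u ⁆ w∈
    ... | inj₁ w∈σ rewrite x∈⁅y⁆⇒x≡y (σ u) w∈σ = Equivalence.from (∈-neighbours G) (adj u)
    ... | inj₂ w∈π rewrite x∈⁅y⁆⇒x≡y (π u) w∈π = Equivalence.from (∈-neighbours G) (adj-π u)

  δ-pair : ∀ S u → δ G S u ≡ [ lookup S (σ u) ]₁ + [ lookup S (π u) ]₁
  δ-pair S u rewrite neighbours-pair u =
    trans (∣∩⁅⁆∪∣ S (x≢y⇒x∉⁅y⁆ (σ≢π u))) (cong ([ lookup S (σ u) ]₁ +_) (∣∩⁅⁆∣ S (π u)))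

  -- The two arguments say whether σ u and π u, the neighbours of u, lie in S.
  strength-of : Bool → Bool → ℕ
  strength-of true  true  = 2 + n
  strength-of false false = n ∸ 2
  strength-of _     _     = n

  -- Membership in `∁ S` is the negation of membership in `S`, so each of the four cases is a
  -- computation.
  strength-pair : ∀ S u → strength G S u ≡ strength-of (lookup S (σ u)) (lookup S (π u))
  strength-pair S u
    rewrite δ-pair S u | δ-pair (∁ S) u
          | lookup-map (σ u) not S | lookup-map (π u) not S
    with lookup S (σ u) | lookup S (π u)
  ... | true  | true  = refl
  ... | true  | false = refl
  ... | false | true  = refl
  ... | false | false = refl

  arc : Fin n → ℕ → Subset n
  arc s zero    = ⊥
  arc s (suc i) = ⁅ fold s σ i ⁆ ∪ arc s i

  ∈-arc⁺ : ∀ s {i k} → k < i → fold s σ k ∈ arc s i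
  ∈-arc⁺ s {suc i} {k} (s≤s k≤i) with m≤n⇒m<n∨m≡n k≤i
  ... | inj₁ k<i  = x∈p∪q⁺ (inj₂ (∈-arc⁺ s k<i))
  ... | inj₂ refl = x∈p∪q⁺ (inj₁ (x∈⁅x⁆ (fold s σ i)))

  ∈-arc⁻ : ∀ s i {w} → w ∈ arc s i → ∃ λ k → k < i × fold s σ k ≡ w
  ∈-arc⁻ s zero    w∈ = contradiction w∈ ∉⊥
  ∈-arc⁻ s (suc i) w∈ with x∈p∪q⁻ ⁅ fold s σ i ⁆ (arc s i) w∈
  ... | inj₁ w∈⁅⁆ = i , ≤-refl , sym (x∈⁅y⁆⇒x≡y (fold s σ i) w∈⁅⁆)
  ... | inj₂ w∈arc with k , k<i , eq ← ∈-arc⁻ s i w∈arc = k , m<n⇒m<1+n k<i , eq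

  ∉-arc : ∀ s {i k} → i ≤ k → k < n → fold s σ k ∉ arc s i
  ∉-arc s {i} i≤k k<n k∈ with l , l<i , eq ← ∈-arc⁻ s i k∈
    with refl ← orbit-injective s (<-≤-trans l<i (≤-trans i≤k (<⇒≤ k<n))) k<n eq = <⇒≱ l<i i≤k

  ∣arc∣ : ∀ s i → i ≤ n → ∣ arc s i ∣ ≡ i
  ∣arc∣ s zero    _   = ∣⊥∣≡0 n
  ∣arc∣ s (suc i) i<n = trans (∣⁅⁆∪∣ (∉-arc s ≤-refl i<n)) (cong suc (∣arc∣ s i (<⇒≤ i<n)))

  s∈arc : ∀ s {i} → 0 < i → s ∈ arc s i
  s∈arc s 0<i = ∈-arc⁺ s 0<i

  -- If `π s` were the `k`-th vertex, one more step would return to `s` after fewer than `n` steps.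
  πs∉arc : ∀ s {i} → i < n → π s ∉ arc s i
  πs∉arc s {i} i<n πs∈ with k , k<i , eq ← ∈-arc⁻ s i πs∈
    with () ← free s (suc k) (≤-<-trans k<i i<n) (trans (cong σ eq) (σπ s))

  arc-connected : ∀ s i → Connected G (arc s i)
  -- Walks are routed through the first vertex `s`.
  arc-connected s i u w u∈ w∈ with k , k<i , refl ← ∈-arc⁻ s i u∈ | l , l<i , refl ← ∈-arc⁻ s i w∈ =
    Star-sym G (from-start k k<i) ◅◅ from-start l l<i
    where
    from-start : ∀ k → k < i → Star (InducedAdj G (arc s i)) s (fold s σ k)
    from-start zero    _   = ε
    from-start (suc k) k<i =
      from-start k (<⇒≤ k<i) ◅◅ (∈-arc⁺ s (<⇒≤ k<i) , ∈-arc⁺ s k<i , adj _) ◅ ε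

  -- The cardinality gives the size. The first vertex is the only one whose predecessor lies
  -- outside: at any later position of `t`'s arc, `π s` would belong to the arc.
  arc-injective : ∀ {s t i j} → 0 < i → i < n → j < n → arc s i ≡ arc t j → i ≡ j × s ≡ t
  arc-injective {s} {t} {i} {j} 0<i i<n j<n eq = i≡j , s≡t
    where
    i≡j : i ≡ j
    i≡j = trans (sym (∣arc∣ s i (<⇒≤ i<n))) (trans (cong ∣_∣ eq) (∣arc∣ t j (<⇒≤ j<n)))
    s≡t : s ≡ t
    s≡t with ∈-arc⁻ t j (subst (s ∈_) eq (s∈arc s 0<i))
    ... | zero  , _   , t≡s = sym t≡s
    ... | suc k , k<j , eq′ = contradiction
      (subst₂ _∈_ (inj (trans eq′ (sym (σπ s)))) (sym eq) (∈-arc⁺ t (<⇒≤ k<j)))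
      (πs∉arc s i<n)

  arc-n : ∀ s → arc s n ≡ ⊤
  arc-n s = ∣p∣≡n⇒p≡⊤ (∣arc∣ s n ≤-refl)

  -- Following the shift from `w`, the first vertex met in `S` has its predecessor outside.
  entry : ∀ {S u w} → u ∈ S → w ∉ S → ∃ λ s → s ∈ S × π s ∉ S
  entry {S} {u} {w} u∈S w∉S
    with m , _ , refl ← reach w u
    with least (λ k → fold w σ k ∈ S) (λ k → fold w σ k ∈? S) m u∈S
  ... | zero  , _ , w∈S , _    = contradiction w∈S w∉S
  ... | suc k , _ , s∈S , none =
    fold w σ (suc k) , s∈S , subst (_∉ S) (sym (inj (σπ (fold w σ (suc k))))) (none ≤-refl)

  -- Following the shift from `s`, the first exit from `S` comes at `π s` at the latest. The arc up
  -- to there has no neighbours in `S` beyond itself, so connectedness makes it all of `S`.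
  connected⇒arc : ∀ {S s} → Connected G S → s ∈ S → π s ∉ S → ∃ λ i → i < n × 0 < i × S ≡ arc s i
  connected⇒arc {S} {s} conn s∈S πs∉S
    with m , m<n , refl-m ← reach s (π s)
    with least (λ k → fold s σ k ∉ S) (λ k → ¬? (fold s σ k ∈? S)) m (subst (_∉ S) (sym refl-m) πs∉S)
  ... | zero  , _ , s∉S , _ = contradiction s∈S s∉S
  ... | i@(suc _) , i≤m , end∉S , inside-S = i , ≤-<-trans i≤m m<n , s≤s z≤n , ⊆-antisym S⊆arc arc⊆S
    where
    arc⊆S : ∀ {w} → w ∈ arc s i → w ∈ S
    arc⊆S w∈ with k , k<i , refl ← ∈-arc⁻ s i w∈ = decidable-stable (fold s σ k ∈? S) (inside-S k<i)
    closed : ∀ {u w} → u ∈ arc s i → InducedAdj G S u w → w ∈ arc s i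
    closed u∈ (_ , w∈S , uw) with ∈-arc⁻ s i u∈ | only uw
    ... | k , k<i , refl | inj₁ refl with m≤n⇒m<n∨m≡n k<i
    ...   | inj₁ 1+k<i = ∈-arc⁺ s 1+k<i
    -- The arc's last vertex: its successor is the exit from `S`.
    ...   | inj₂ refl  = contradiction w∈S end∉S
    -- Backwards from the first vertex the only neighbour is `π s`.
    closed u∈ (_ , w∈S , uw) | zero  , _   , refl | inj₂ s≡σw =
      contradiction (subst (_∈ S) (inj (trans (sym s≡σw) (sym (σπ s)))) w∈S) πs∉S
    closed u∈ (_ , w∈S , uw) | suc k , k<i , refl | inj₂ eq =
      subst (_∈ arc s i) (inj eq) (∈-arc⁺ s (<⇒≤ k<i))
    spread : ∀ {u w} → u ∈ arc s i → Star (InducedAdj G S) u w → w ∈ arc s i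
    spread u∈ ε        = u∈
    spread u∈ (r ◅ rs) = spread (closed u∈ r) rs
    S⊆arc : ∀ {w} → w ∈ S → w ∈ arc s i
    S⊆arc w∈S = spread (s∈arc s {i} (s≤s z≤n)) (conn s _ s∈S w∈S)

  -- The argument is one less than the size of the arc, so the first case is a single vertex.
  exponent : ℕ → ℕ
  exponent zero    = n ∸ 2
  exponent (suc _) = n

  -- The minimum is attained at the first vertex, whose predecessor is outside. In an arc with at
  -- least two vertices each vertex has a neighbour inside: `σ s` for `s` itself and the predecessor
  -- for every other.
  term-arc : ∀ s k → suc k < n → term G (arc s (suc k)) ≡ [ (1 , suc k , exponent k) ]
  term-arc s k 1+k<n = trans
    (term-connected G (s , s∈) (arc-connected s (suc k)) (f-y-≡ G (lower k 1+k<n) (s , s∈ , attained k 1+k<n)))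
    (cong (λ i → [ (1 , i , exponent k) ]) (∣arc∣ s (suc k) (<⇒≤ 1+k<n)))
    where
    s∈ : s ∈ arc s (suc k)
    s∈ = s∈arc s {suc k} (s≤s z≤n)
    attained : ∀ k → suc k < n → strength G (arc s (suc k)) s ≡ exponent k
    attained zero    1<n
      rewrite strength-pair (arc s 1) s
            | lookup-∉ (∉-arc s {1} {1} ≤-refl 1<n) | lookup-∉ (πs∉arc s {1} 1<n) = refl
    attained (suc k) 2+k<n
      rewrite strength-pair (arc s (2 + k)) s
            | []=⇒lookup (∈-arc⁺ s {2 + k} {1} (s≤s (s≤s z≤n)))
            | lookup-∉ (πs∉arc s {2 + k} 2+k<n) = refl
    n≤strength-σ : ∀ {S} u → σ u ∈ S → n ≤ strength G S u
    n≤strength-σ {S} u σu∈ rewrite strength-pair S u | []=⇒lookup σu∈ with lookup S (π u)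
    ... | true  = m≤n+m n 2
    ... | false = ≤-refl
    n≤strength-π : ∀ {S} u → π u ∈ S → n ≤ strength G S u
    n≤strength-π {S} u πu∈ rewrite strength-pair S u | []=⇒lookup πu∈ with lookup S (σ u)
    ... | true  = m≤n+m n 2
    ... | false = ≤-refl
    lower : ∀ k → suc k < n → ∀ {u} → u ∈ arc s (suc k) → exponent k ≤ strength G (arc s (suc k)) u
    lower k 1+k<n u∈ with ∈-arc⁻ s (suc k) u∈
    lower zero    1<n   u∈ | zero , _ , refl = ≤-reflexive (sym (attained 0 1<n))
    lower zero    1<n   u∈ | suc _ , s≤s () , _
    lower (suc k) 2+k<n u∈ | zero , _ , refl = n≤strength-σ s (∈-arc⁺ s {2 + k} {1} (s≤s (s≤s z≤n)))
    lower (suc k) 2+k<n u∈ | suc l , l<k , refl =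
      n≤strength-π (fold s σ (suc l))
        (subst (_∈ arc s (2 + k)) (inj (sym (σπ (fold s σ (suc l))))) (∈-arc⁺ s (<⇒≤ l<k)))

  term-⊤ : Fin n → term G ⊤ ≡ [ (1 , n , n + 2) ]
  term-⊤ s = trans
    (term-connected G (s , ∈⊤) (subst (Connected G) (arc-n s) (arc-connected s n))
      (f-y-≡ G (λ {u} _ → ≤-reflexive (sym (strength-⊤ u))) (s , ∈⊤ , strength-⊤ s)))
    (cong (λ i → [ (1 , i , n + 2) ]) (∣⊤∣≡n n))
    where
    strength-⊤ : ∀ u → strength G ⊤ u ≡ n + 2
    strength-⊤ u
      rewrite strength-pair ⊤ u | lookup-replicate (σ u) true | lookup-replicate (π u) true = +-comm 2 n

  -- Sizes run from 1 to n - 1; size n is left out because there all first vertices give `⊤`.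
  proper-arc : Fin (n ∸ 1) → Fin n → Subset n
  proper-arc k s = arc s (suc (toℕ k))

  proper-arcs : List (Subset n)
  proper-arcs = cartesianProductWith proper-arc (allFin (n ∸ 1)) (allFin n)

  connected-subsets : List (Subset n)
  connected-subsets = ⊤ ∷ proper-arcs

  1+toℕ<n : (k : Fin (n ∸ 1)) → suc (toℕ k) < n
  1+toℕ<n k = subst (suc (toℕ k) <_) (m+[n∸m]≡n (≤-trans (s≤s z≤n) 3≤n)) (s≤s (Fin.toℕ<n k))

  connected-subsets-unique : Unique connected-subsets
  connected-subsets-unique =
    All.tabulate ⊤≢ ∷
    Unique.cartesianProductWith⁺ proper-arc injective (Unique.allFin⁺ (n ∸ 1)) (Unique.allFin⁺ n)
    where
    injective : ∀ {k l s t} → proper-arc k s ≡ proper-arc l t → k ≡ l × s ≡ t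
    injective {k} {l} eq with eq₁ , eq₂ ← arc-injective (s≤s z≤n) (1+toℕ<n k) (1+toℕ<n l) eq =
      Fin.toℕ-injective (suc-injective eq₁) , eq₂
    ⊤≢ : ∀ {S} → S ∈ᴸ proper-arcs → ⊤ ≢ S
    ⊤≢ S∈ refl
      with k , s , _ , _ , eq ← ∈-cartesianProductWith⁻ proper-arc (allFin (n ∸ 1)) (allFin n) S∈ =
      πs∉arc s (1+toℕ<n k) (subst (π s ∈_) eq ∈⊤)

  connected⇒∈ : ∀ {S} → Nonempty S → Connected G S → S ∈ᴸ connected-subsets
  connected⇒∈ {S} (u , u∈S) conn with Fin.any? (λ w → ¬? (w ∈? S))
  ... | no all∈S = here (⊆-antisym ⊆⊤ λ {w} _ → decidable-stable (w ∈? S) λ w∉S → all∈S (w , w∉S))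
  ... | yes (w , w∉S)
    with s , s∈S , πs∉S ← entry u∈S w∉S
    with suc i , i<n , _ , refl ← connected⇒arc conn s∈S πs∉S =
    there (subst (λ k → arc s (suc k) ∈ᴸ _) (Fin.toℕ-fromℕ< i<n-1)
      (∈-cartesianProductWith⁺ proper-arc (∈-allFin (fromℕ< i<n-1)) (∈-allFin s)))
    where
    i<n-1 : i < n ∸ 1
    i<n-1 = ∸-monoˡ-≤ 1 i<n

  -- Only connected sets contribute to a coefficient: `⊤` once, and for each smaller size the n arcs
  -- of that size with equal terms.
  da-cycle : da G ≈ₚ cycleFormula n
  da-cycle i j = begin
    coeff (da G) i j             ≡⟨ coeff-da G i j ⟩
    sum (map g (subsets n))      ≡⟨ sum-map-support g (subsets-unique n) connected-subsets-unique
                                      support (λ {S} _ → ∈-subsets S) ⟩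
    g ⊤ + sum (map g proper-arcs)
                                 ≡⟨ cong₂ _+_ g-⊤ arcs ⟩
    mono 1 n (n + 2) i j + sum (map h (upTo (n ∸ 1)))
                                 ≡⟨ +-comm (mono 1 n (n + 2) i j) _ ⟩
    sum (map h (upTo (n ∸ 1))) + mono 1 n (n + 2) i j
                                 ≡⟨ cong (_+ mono 1 n (n + 2) i j) (split 3≤n) ⟩
    mono n 1 (n ∸ 2) i j + sum (map (λ k → mono n (2 + k) n i j) (upTo (n ∸ 2))) + mono 1 n (n + 2) i j
                                 ≡⟨ coeff-cycleFormula n i j (≤-trans (n≤1+n 2) 3≤n) ⟨
    coeff (cycleFormula n) i j   ∎
    where
    open ≡-Reasoning
    g : Subset n → ℕ
    g S = coeff (term G S) i j
    h : ℕ → ℕ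
    h k = mono n (suc k) (exponent k) i j
    start : Fin n
    start = fromℕ< (≤-trans (s≤s z≤n) 3≤n)
    support : ∀ {S} → S ∈ᴸ subsets n → g S ≢ 0 → S ∈ᴸ connected-subsets
    support _ ≢0 = let ne , conn , _ = coeff-term-≢0 G i j ≢0 in connected⇒∈ ne conn
    g-⊤ : g ⊤ ≡ mono 1 n (n + 2) i j
    g-⊤ rewrite term-⊤ start = coeff-monomial 1 n (n + 2) i j
    g-arc : ∀ k s → g (proper-arc k s) ≡ mono 1 (suc (toℕ k)) (exponent (toℕ k)) i j
    g-arc k s rewrite term-arc s (toℕ k) (1+toℕ<n k) = coeff-monomial 1 (suc (toℕ k)) (exponent (toℕ k)) i j
    arcs : sum (map g proper-arcs) ≡ sum (map h (upTo (n ∸ 1)))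
    arcs = trans
      (sum-map-cartesianProductWith proper-arc g _ g-arc (allFin (n ∸ 1)) (allFin n))
      (sum-map-applyUpTo h (λ k → length (allFin n) * mono 1 (suc (toℕ k)) (exponent (toℕ k)) i j)
        (λ k → k) {n ∸ 1} (λ k → k) λ k → trans
        (cong (_* mono 1 (suc (toℕ k)) (exponent (toℕ k)) i j) (length-tabulate {n = n} (λ s → s)))
        (*-mono n (suc (toℕ k)) (exponent (toℕ k)) i j))
    -- Single vertices are separated from the longer arcs, whose exponent of y is n.
    split : 3 ≤ n → sum (map h (upTo (n ∸ 1))) ≡
            mono n 1 (n ∸ 2) i j + sum (map (λ k → mono n (2 + k) n i j) (upTo (n ∸ 2)))
    split (s≤s (s≤s (s≤s {n = n′} z≤n))) =
      cong (λ ks → h 0 + sum ks)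
        (trans (map-applyUpTo suc h (suc n′))
          (sym (map-applyUpTo (λ k → k) (λ k → mono n (2 + k) n i j) (suc n′))))

-- The shift of a cycle

next : ∀ {n} → Fin (suc n) → Fin (suc n)
next {n} u with suc (toℕ u) <? suc n
... | yes 1+u<n = fromℕ< 1+u<n
... | no  _     = zero

Next-next : ∀ {n} (u : Fin (suc n)) → Next u (next u)
Next-next {n} u with suc (toℕ u) <? suc n
... | yes 1+u<n = inj₁ (sym (Fin.toℕ-fromℕ< 1+u<n))
... | no  1+u≮n = inj₂ (≤-antisym (Fin.toℕ<n u) (≮⇒≥ 1+u≮n) , refl)

Next-functional : ∀ {n} {u v w : Fin n} → Next u v → Next u w → v ≡ w
Next-functional         (inj₁ p)       (inj₁ q)       = Fin.toℕ-injective (trans (sym p) q)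
Next-functional {v = v} (inj₁ p)       (inj₂ (q , _)) =
  contradiction (trans (sym p) q) (<⇒≢ (Fin.toℕ<n v))
Next-functional {w = w} (inj₂ (p , _)) (inj₁ q)       =
  contradiction (trans (sym q) p) (<⇒≢ (Fin.toℕ<n w))
Next-functional         (inj₂ (_ , p)) (inj₂ (_ , q)) = Fin.toℕ-injective (trans p (sym q))

Next-injective : ∀ {n} {u v w : Fin n} → Next u w → Next v w → u ≡ v
Next-injective (inj₁ p)       (inj₁ q)       = Fin.toℕ-injective (suc-injective (trans p (sym q)))
Next-injective (inj₁ p)       (inj₂ (_ , q)) = contradiction (trans p q) 1+n≢0
Next-injective (inj₂ (_ , p)) (inj₁ q)       = contradiction (trans q p) 1+n≢0
Next-injective (inj₂ (p , _)) (inj₂ (q , _)) = Fin.toℕ-injective (suc-injective (trans p (sym q)))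

-- Each step adds 1 modulo `suc n`; `q` counts the passages from the last label to 0.
toℕ-fold-next : ∀ {n} (u : Fin (suc n)) k → ∃ λ q → toℕ (fold u next k) + q * suc n ≡ toℕ u + k
toℕ-fold-next {n} u zero    = 0 , refl
toℕ-fold-next {n} u (suc k) with toℕ-fold-next u k | Next-next (fold u next k)
... | q , eq | inj₁ step = q , (begin
    toℕ (fold u next (suc k)) + q * suc n ≡⟨ cong (_+ q * suc n) step ⟨
    suc (toℕ (fold u next k) + q * suc n) ≡⟨ cong suc eq ⟩
    suc (toℕ u + k)                       ≡⟨ +-suc (toℕ u) k ⟨
    toℕ u + suc k                         ∎)
  where open ≡-Reasoning
... | q , eq | inj₂ (last , wrap) = suc q , (begin
    toℕ (fold u next (suc k)) + suc q * suc n ≡⟨ cong (_+ suc q * suc n) wrap ⟩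
    suc n + q * suc n                         ≡⟨ cong (_+ q * suc n) last ⟨
    suc (toℕ (fold u next k) + q * suc n)     ≡⟨ cong suc eq ⟩
    suc (toℕ u + k)                           ≡⟨ +-suc (toℕ u) k ⟨
    toℕ u + suc k                             ∎)
  where open ≡-Reasoning

-- A return after `k` steps makes `k` a multiple of `suc n`, and only the multiple 0 is small
-- enough.
next-free : ∀ {n} (u : Fin (suc n)) k → k < suc n → fold u next k ≡ u → k ≡ 0
next-free {n} u k k<n eq with toℕ-fold-next u k
... | zero  , eq′ = sym (+-cancelˡ-≡ (toℕ u) 0 k (trans (cong (λ w → toℕ w + 0) (sym eq)) eq′))
... | suc q , eq′ = contradiction (subst (suc n ≤_) multiple (m≤m+n (suc n) (q * suc n))) (<⇒≱ k<n)
  where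
  multiple : suc q * suc n ≡ k
  multiple = +-cancelˡ-≡ (toℕ u) (suc q * suc n) k
    (trans (cong (λ w → toℕ w + suc q * suc n) (sym eq)) eq′)

-- The shift is `next` transported along the isomorphism; its properties are checked on the labels.
≅-cycle⇒shift : ∀ {n} (3≤n : 3 ≤ n) {G : Graph n} → G ≅ cycle n 3≤n → CyclicShift G
≅-cycle⇒shift {suc n} 3≤n {G} (f , adj⇔) = record
  { σ    = σ
  ; adj  = λ u → Equivalence.from (adj⇔ u (σ u)) (inj₁ (Next-σ u))
  ; only = only
  ; inj  = λ {u} {w} eq → to-injective
      (Next-injective (Next-σ u) (subst (Next (to w)) (cong to (sym eq)) (Next-σ w)))
  ; free = λ u k k<n eq → next-free (to u) k k<n (trans (sym (to-fold u k)) (cong to eq))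
  }
  where
  open Inverse f using (to; from; strictlyInverseˡ; strictlyInverseʳ)
  σ : Fin (suc n) → Fin (suc n)
  σ u = from (next (to u))
  to-σ : ∀ u → to (σ u) ≡ next (to u)
  to-σ u = strictlyInverseˡ (next (to u))
  Next-σ : ∀ u → Next (to u) (to (σ u))
  Next-σ u = subst (Next (to u)) (sym (to-σ u)) (Next-next (to u))
  to-injective : ∀ {u w} → to u ≡ to w → u ≡ w
  to-injective {u} {w} eq = trans (sym (strictlyInverseʳ u)) (trans (cong from eq) (strictlyInverseʳ w))
  only : ∀ {u w} → Graph.Adj G u w → w ≡ σ u ⊎ u ≡ σ w
  only {u} {w} uw with Equivalence.to (adj⇔ u w) uw
  ... | inj₁ u→w = inj₁ (to-injective (Next-functional u→w (Next-σ u)))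
  ... | inj₂ w→u = inj₂ (to-injective (Next-functional w→u (Next-σ w)))
  to-fold : ∀ u k → to (fold u σ k) ≡ fold (to u) next k
  to-fold u zero    = refl
  to-fold u (suc k) = trans (to-σ (fold u σ k)) (cong next (to-fold u k))

≅⇒≡ : ∀ {m n} {G : Graph m} {H : Graph n} → G ≅ H → m ≡ n
≅⇒≡ (f , _) = Fin.cantor-schröder-bernstein
  (Injection.injective (↔⇒↣ f)) (Injection.injective (↔⇒↣ (↔-sym f)))

-- Isomorphic graphs have equally many vertices. Isomorphism compares adjacency alone, which is the
-- same for both proofs that the length is at least 3.
≅-cycle-resize : ∀ {m j n} {G : Graph m} (3≤j : 3 ≤ j) (3≤n : 3 ≤ n) →
  G ≅ cycle j 3≤j → m ≡ n → G ≅ cycle n 3≤n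
≅-cycle-resize {G = G} 3≤j 3≤n iso refl with refl ← ≅⇒≡ {G = G} {cycle _ 3≤j} iso = iso

≅-cycle⇒da : ∀ n (3≤n : 3 ≤ n) m (G : Graph m) → G ≅ cycle n 3≤n → da G ≈ₚ cycleFormula n
≅-cycle⇒da n 3≤n m G iso with refl ← ≅⇒≡ {G = G} {cycle n 3≤n} iso =
  Arcs.da-cycle 3≤n G (≅-cycle⇒shift 3≤n iso)

-- Connected 2-regular graphs are cycles

-- The walk is infinite in one direction. The field `only` records 2-regularity along it: a vertex
-- at a positive index has just the two neighbours beside it on the walk.
record NonBacktrackingWalk {n : ℕ} (G : Graph n) : Set where
  open Graph G
  field
    v    : ℕ → Fin n
    step : ∀ k → Adj (v k) (v (suc k))
    turn : ∀ k → v (2 + k) ≢ v k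
    only : ∀ k {z} → Adj (v (suc k)) z → z ≡ v k ⊎ z ≡ v (2 + k)

module Cover {n : ℕ} (G : Graph n) (walk : NonBacktrackingWalk G) (conn : Connected G ⊤) where
  open Graph G
  open NonBacktrackingWalk walk

  Repeat : ℕ → Set
  Repeat j = ∃ λ i → i < j × v i ≡ v j

  repeat? : ∀ j → Dec (Repeat j)
  repeat? j = anyUpTo? (λ i → v i Fin.≟ v j) j

  -- Otherwise the predecessor of v j would be a neighbour of v i = v j, hence
  -- one of v (i - 1) and v (i + 1): an earlier repetition or a turn.
  repeats-at-start : ∀ {j} → (∀ {l} → l < j → ¬ Repeat l) → Repeat j → v 0 ≡ v j
  repeats-at-start none (zero , _ , eq) = eq
  repeats-at-start {suc j} none (suc i , s≤s i<j , eq)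
    with only i (subst (λ u → Adj u (v j)) (sym eq) (adj-sym (step j)))
  ... | inj₁ vj≡vi   = contradiction (i , i<j , sym vj≡vi) (none ≤-refl)
  ... | inj₂ vj≡v2+i with m≤n⇒m<n∨m≡n i<j
  ...   | inj₂ refl  = contradiction (step j) (adj-irrefl eq)
  ...   | inj₁ 1+i<j with m≤n⇒m<n∨m≡n 1+i<j
  ...     | inj₁ 2+i<j = contradiction (2 + i , 2+i<j , sym vj≡v2+i) (none ≤-refl)
  ...     | inj₂ refl  = contradiction (sym eq) (turn (suc i))

  -- The first repetition is a return to the start at index `3 + j`, so the vertices before it are
  -- distinct and form a closed walk.
  module Closed {j : ℕ} (none : ∀ {l} → l < 3 + j → ¬ Repeat l) (close : v 0 ≡ v (3 + j)) where

    v-injective : ∀ {i l} → i < 3 + j → l < 3 + j → v i ≡ v l → i ≡ l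
    v-injective {i} {l} i<j l<j eq with <-cmp i l
    ... | tri< i<l _ _ = contradiction (i , i<l , eq) (none l<j)
    ... | tri≈ _ i≡l _ = i≡l
    ... | tri> _ _ l<i = contradiction (l , l<i , sym eq) (none i<j)

    -- As a neighbour of `v (3 + j)`, the vertex `v 1` is `v (2 + j)` or `v (4 + j)`, and
    -- injectivity excludes the former.
    close-next : v 1 ≡ v (4 + j)
    close-next with only (2 + j) (subst (λ u → Adj u (v 1)) close (step 0))
    ... | inj₂ eq = eq
    ... | inj₁ eq with () ← v-injective (s≤s (s≤s z≤n)) ≤-refl eq

    -- Since `only` speaks of positive indices, `v 0` is treated as `v (3 + j)`.
    closed : ∀ {k z} → k < 3 + j → Adj (v k) z → ∃ λ l → l < 3 + j × v l ≡ z
    closed {zero} _ uz with only (2 + j) (subst (λ u → Adj u _) close uz)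
    ... | inj₁ refl = 2 + j , ≤-refl , refl
    ... | inj₂ z≡   = 1 , s≤s (s≤s z≤n) , trans close-next (sym z≡)
    closed {suc k} k<j uz with only k uz
    ... | inj₁ refl = k , <⇒≤ k<j , refl
    ... | inj₂ refl with m≤n⇒m<n∨m≡n k<j
    ...   | inj₁ 2+k<j = 2 + k , 2+k<j , refl
    ...   | inj₂ refl  = 0 , s≤s z≤n , close

    -- The vertices of the closed walk contain all their neighbours, and the graph is connected.
    v-surjective : ∀ z → ∃ λ l → l < 3 + j × v l ≡ z
    v-surjective z = spread (0 , s≤s z≤n , refl) (conn (v 0) z ∈⊤ ∈⊤)
      where
      spread : ∀ {u w} → (∃ λ l → l < 3 + j × v l ≡ u) → Star (InducedAdj G ⊤) u w →
               ∃ λ l → l < 3 + j × v l ≡ w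
      spread found            ε                    = found
      spread (l , l<j , refl) ((_ , _ , uw) ◅ rs) = spread (closed l<j uw) rs

    index : Fin n → Fin (3 + j)
    index z = fromℕ< (proj₁ (proj₂ (v-surjective z)))

    v-index : ∀ z → v (toℕ (index z)) ≡ z
    v-index z = trans (cong v (Fin.toℕ-fromℕ< (proj₁ (proj₂ (v-surjective z))))) (proj₂ (proj₂ (v-surjective z)))

    index-v : ∀ k → index (v (toℕ k)) ≡ k
    index-v k = Fin.toℕ-injective
      (v-injective (Fin.toℕ<n (index (v (toℕ k)))) (Fin.toℕ<n k) (v-index (v (toℕ k))))

    v-Adj⇒Next : ∀ a b → Adj (v (toℕ a)) (v (toℕ b)) → Next a b ⊎ Next {3 + j} b a
    v-Adj⇒Next zero b uw with only (2 + j) (subst (λ u → Adj u (v (toℕ b))) close uw)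
    ... | inj₁ eq = inj₂ (inj₂ (cong suc (v-injective (Fin.toℕ<n b) ≤-refl eq) , refl))
    ... | inj₂ eq = inj₁ (inj₁ (sym (v-injective (Fin.toℕ<n b) (s≤s (s≤s z≤n)) (trans eq (sym close-next)))))
    v-Adj⇒Next (suc a) b uw with only (toℕ a) uw
    ... | inj₁ eq = inj₂ (inj₁ (cong suc (v-injective (Fin.toℕ<n b) (<⇒≤ (s≤s (Fin.toℕ<n a))) eq)))
    ... | inj₂ eq with m≤n⇒m<n∨m≡n (Fin.toℕ<n (suc a))
    ...   | inj₁ 2+a<j = inj₁ (inj₁ (sym (v-injective (Fin.toℕ<n b) 2+a<j eq)))
    -- Here `suc a` is the last index, whose successor on the walk is `v (3 + j)`, that is, `v 0`.
    ...   | inj₂ 2+a≡j = inj₁ (inj₂ (2+a≡j ,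
      v-injective (Fin.toℕ<n b) (s≤s z≤n) (trans eq (trans (cong v 2+a≡j) (sym close)))))

    Next⇒v-Adj : ∀ {a b : Fin (3 + j)} → Next a b → Adj (v (toℕ a)) (v (toℕ b))
    Next⇒v-Adj {a} {b} (inj₁ eq) = subst (λ k → Adj (v (toℕ a)) (v k)) eq (step (toℕ a))
    Next⇒v-Adj {a} {b} (inj₂ (last , wrap)) =
      subst (Adj (v (toℕ a))) (trans (cong v last) (trans (sym close) (cong v (sym wrap)))) (step (toℕ a))

    ≅-cycle : G ≅ cycle (3 + j) (s≤s (s≤s (s≤s z≤n)))
    ≅-cycle = mk↔ₛ′ index (v ∘ toℕ) index-v v-index , λ u w → mk⇔
      (v-Adj⇒Next (index u) (index w) ∘ subst₂ Adj (sym (v-index u)) (sym (v-index w)))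
      (subst₂ Adj (v-index u) (v-index w) ∘
        λ { (inj₁ p) → Next⇒v-Adj p ; (inj₂ p) → adj-sym (Next⇒v-Adj p) })

  -- A first repetition at index 1 would be a loop and at index 2 a turn, so the cycle has length at
  -- least 3.
  ≅-cycle-at : ∀ j → (∀ {l} → l < j → ¬ Repeat l) → Repeat j → ∃₂ λ j (3≤j : 3 ≤ j) → G ≅ cycle j 3≤j
  ≅-cycle-at 0 none (_ , () , _)
  ≅-cycle-at 1 none repeat = contradiction (step 0) (adj-irrefl (repeats-at-start none repeat))
  ≅-cycle-at 2 none repeat = contradiction (sym (repeats-at-start none repeat)) (turn 0)
  ≅-cycle-at (suc (suc (suc j))) none repeat =
    3 + j , s≤s (s≤s (s≤s z≤n)) , Closed.≅-cycle none (repeats-at-start none repeat)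

  -- Among the first n + 1 vertices of the walk two coincide by the pigeonhole principle; the least
  -- repetition is then taken.
  ≅-cycle : ∃₂ λ j (3≤j : 3 ≤ j) → G ≅ cycle j 3≤j
  ≅-cycle =
    let i , k , i<k , eq = Fin.pigeonhole (n<1+n n) (v ∘ toℕ)
        j , _ , repeat , none = least Repeat repeat? (toℕ k) (toℕ i , i<k , eq)
    in ≅-cycle-at j none repeat

module TwoRegular {n : ℕ} (G : Graph n) (deg≡2 : ∀ u → ∣ neighbours G u ∣ ≡ 2) where
  open Graph G

  two-neighbours : ∀ u → ∃₂ λ a b → a ≢ b × Adj u a × Adj u b × (∀ {z} → Adj u z → z ≡ a ⊎ z ≡ b)
  two-neighbours u with a , b , a≢b , eq ← ∣p∣≡2⇒pair (neighbours G u) (deg≡2 u) =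
    a , b , a≢b
    , Equivalence.to (∈-neighbours G) (subst (a ∈_) (sym eq) (x∈p∪q⁺ (inj₁ (x∈⁅x⁆ a))))
    , Equivalence.to (∈-neighbours G) (subst (b ∈_) (sym eq) (x∈p∪q⁺ (inj₂ (x∈⁅x⁆ b))))
    , λ uz → map-⊎ (x∈⁅y⁆⇒x≡y a) (x∈⁅y⁆⇒x≡y b)
        (x∈p∪q⁻ ⁅ a ⁆ ⁅ b ⁆ (subst (_ ∈_) eq (Equivalence.from (∈-neighbours G) uz)))

  other : ∀ {u w} → Adj u w → ∃ λ w′ → Adj u w′ × w′ ≢ w × (∀ {z} → Adj u z → z ≡ w ⊎ z ≡ w′)
  other {u} {w} uw with two-neighbours u
  ... | a , b , a≢b , ua , ub , only with only uw
  ...   | inj₁ refl = b , ub , a≢b ∘ sym , only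
  ...   | inj₂ refl = a , ua , a≢b , swap ∘ only

  Dart : Set
  Dart = ∃₂ Adj

  -- A walk that never turns back is determined by its current directed edge: from `w`, entered from
  -- `u`, it leaves by the other neighbour.
  turn-dart : Dart → Dart
  turn-dart (u , w , uw) = w , proj₁ (other (adj-sym uw)) , proj₁ (proj₂ (other (adj-sym uw)))

  walk : Fin n → NonBacktrackingWalk G
  walk s = record
    { v    = proj₁ ∘ dart
    ; step = λ k → proj₂ (proj₂ (dart k))
    ; turn = λ k → proj₁ (proj₂ (proj₂ (other (adj-sym (proj₂ (proj₂ (dart k)))))))
    ; only = λ k → proj₂ (proj₂ (proj₂ (other (adj-sym (proj₂ (proj₂ (dart k)))))))
    }
    where
    dart : ℕ → Dart
    dart = fold (s , proj₁ (two-neighbours s) , proj₁ (proj₂ (proj₂ (proj₂ (two-neighbours s))))) turn-dart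

-- Reading the graph off the polynomial

module FromPolynomial
  (n : ℕ) (3≤n : 3 ≤ n) (m : ℕ) (G : Graph m) (da≈ : da G ≈ₚ cycleFormula n) where
  open Graph G

  -- All summands but the first have degree at least 2 in x.
  coeff-linear : 3 ≤ n → ∀ j → coeff (cycleFormula n) 1 j ≡ mono n 1 (n ∸ 2) 1 j
  coeff-linear (s≤s (s≤s (s≤s {n = n′} z≤n))) j = begin
    coeff (cycleFormula n) 1 j ≡⟨ coeff-cycleFormula n 1 j (s≤s (s≤s z≤n)) ⟩
    mono n 1 (n ∸ 2) 1 j + sum (map (λ k → mono n (2 + k) n 1 j) (upTo (n ∸ 2))) + 0
      ≡⟨ +-identityʳ _ ⟩
    mono n 1 (n ∸ 2) 1 j + sum (map (λ k → mono n (2 + k) n 1 j) (upTo (n ∸ 2)))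
      ≡⟨ cong (mono n 1 (n ∸ 2) 1 j +_)
           (trans (sum-map-const (λ k → refl) (upTo (n ∸ 2))) (*-zeroʳ (length (upTo (n ∸ 2))))) ⟩
    mono n 1 (n ∸ 2) 1 j + 0   ≡⟨ +-identityʳ _ ⟩
    mono n 1 (n ∸ 2) 1 j       ∎
    where open ≡-Reasoning

  term-singleton : ∀ u → term G ⁅ u ⁆ ≡ [ (1 , 1 , strength G ⁅ u ⁆ u) ]
  term-singleton u = trans
    (term-connected G (u , x∈⁅x⁆ u) connected
      (f-y-≡ G (λ w∈ → ≤-reflexive (cong (strength G ⁅ u ⁆) (sym (x∈⁅y⁆⇒x≡y u w∈)))) (u , x∈⁅x⁆ u , refl)))
    (cong (λ i → [ (1 , i , strength G ⁅ u ⁆ u) ]) (∣⁅x⁆∣≡1 u))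
    where
    connected : Connected G ⁅ u ⁆
    connected v w v∈ w∈ rewrite x∈⁅y⁆⇒x≡y u v∈ | x∈⁅y⁆⇒x≡y u w∈ = ε

  -- The set `⁅ u ⁆` makes the coefficient of x yᵉ positive, with e its strength, while n - 2 is the
  -- only exponent of y that the formula has beside x.
  strength-singleton : ∀ u → strength G ⁅ u ⁆ u ≡ n ∸ 2
  strength-singleton u = sym (proj₂ (mono-≢0 n 1 (n ∸ 2) 1 e (λ ≡0 → n≮0 (subst (1 ≤_) ≡0 1≤))))
    where
    open ≤-Reasoning
    e = strength G ⁅ u ⁆ u
    1≤ : 1 ≤ mono n 1 (n ∸ 2) 1 e
    1≤ = begin
      1                                                     ≡⟨ mono-self 1 1 e ⟨
      mono 1 1 e 1 e                                        ≡⟨ coeff-monomial 1 1 e 1 e ⟨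
      coeff [ (1 , 1 , e) ] 1 e                             ≡⟨ cong (λ p → coeff p 1 e) (term-singleton u) ⟨
      coeff (term G ⁅ u ⁆) 1 e                              ≤⟨ sum-map-≥ (λ S → coeff (term G S) 1 e) (∈-subsets ⁅ u ⁆) ⟩
      sum (map (λ S → coeff (term G S) 1 e) (subsets m))    ≡⟨ coeff-da G 1 e ⟨
      coeff (da G) 1 e                                      ≡⟨ da≈ 1 e ⟩
      coeff (cycleFormula n) 1 e                            ≡⟨ coeff-linear 3≤n e ⟩
      mono n 1 (n ∸ 2) 1 e                                  ∎

  -- Compare the coefficients of x yⁿ⁻²: each vertex contributes 1 to the polynomial, and the
  -- formula has n.
  m≡n : m ≡ n
  m≡n = begin
    m                                             ≡⟨ *-identityʳ m ⟨
    m * 1                                         ≡⟨ cong (_* 1) (length-tabulate {n = m} (λ u → u)) ⟨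
    length (allFin m) * 1                         ≡⟨ sum-map-const g-singleton (allFin m) ⟨
    sum (map (g ∘ ⁅_⁆) (allFin m))                ≡⟨ cong sum (map-∘ (allFin m)) ⟩
    sum (map g (map ⁅_⁆ (allFin m)))              ≡⟨ sum-map-support g (subsets-unique m)
                                                       (Unique.map⁺ ⁅⁆-injective (Unique.allFin⁺ m))
                                                       (λ {S} _ → is-singleton S)
                                                       (λ {S} _ → ∈-subsets S) ⟨
    sum (map g (subsets m))                       ≡⟨ coeff-da G 1 (n ∸ 2) ⟨
    coeff (da G) 1 (n ∸ 2)                        ≡⟨ da≈ 1 (n ∸ 2) ⟩
    coeff (cycleFormula n) 1 (n ∸ 2)              ≡⟨ coeff-linear 3≤n (n ∸ 2) ⟩
    mono n 1 (n ∸ 2) 1 (n ∸ 2)                    ≡⟨ mono-self n 1 (n ∸ 2) ⟩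
    n                                             ∎
    where
    open ≡-Reasoning
    g : Subset m → ℕ
    g S = coeff (term G S) 1 (n ∸ 2)
    g-singleton : ∀ u → g ⁅ u ⁆ ≡ 1
    g-singleton u rewrite term-singleton u | strength-singleton u =
      trans (coeff-monomial 1 1 (n ∸ 2) 1 (n ∸ 2)) (mono-self 1 1 (n ∸ 2))
    ⁅⁆-injective : ∀ {u w : Fin m} → ⁅ u ⁆ ≡ ⁅ w ⁆ → u ≡ w
    ⁅⁆-injective {u} {w} eq = x∈⁅y⁆⇒x≡y w (subst (u ∈_) eq (x∈⁅x⁆ u))
    is-singleton : ∀ S → g S ≢ 0 → S ∈ᴸ map ⁅_⁆ (allFin m)
    is-singleton S ≢0 with _ , _ , ∣S∣≡1 ← coeff-term-≢0 G 1 (n ∸ 2) ≢0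
      with u , refl ← ∣p∣≡1⇒singleton S ∣S∣≡1 = ∈-map⁺ ⁅_⁆ (∈-allFin u)

  neighbours⊆∁ : ∀ u → ∁ ⁅ u ⁆ ∩ neighbours G u ≡ neighbours G u
  neighbours⊆∁ u = ⊆-antisym (p∩q⊆q (∁ ⁅ u ⁆) (neighbours G u)) λ w∈ →
    x∈p∩q⁺ (x∉p⇒x∈∁p (w≢u w∈ ∘ x∈⁅y⁆⇒x≡y u) , w∈)
    where
    w≢u : ∀ {w} → w ∈ neighbours G u → w ≢ u
    w≢u w∈ w≡u = adj-irrefl (sym w≡u) (Equivalence.to (∈-neighbours G) w∈)

  -- The strength of a single vertex is `m` minus its degree, and it equals `m ∸ 2`. Truncated
  -- subtraction cancels because both subtrahends are at most `m`.
  degree : ∀ u → ∣ neighbours G u ∣ ≡ 2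
  degree u = ∸-cancelˡ-≡ (∣p∣≤n (neighbours G u)) (≤-trans (n≤1+n 2) (subst (3 ≤_) (sym m≡n) 3≤n)) (begin
    m ∸ ∣ neighbours G u ∣                 ≡⟨ cong₂ (λ d p → d + m ∸ ∣ p ∣) δ≡0 (neighbours⊆∁ u) ⟨
    strength G ⁅ u ⁆ u                      ≡⟨ strength-singleton u ⟩
    n ∸ 2                                   ≡⟨ cong (_∸ 2) m≡n ⟨
    m ∸ 2                                   ∎)
    where
    open ≡-Reasoning
    δ≡0 : δ G ⁅ u ⁆ u ≡ 0
    δ≡0 = begin
      ∣ ⁅ u ⁆ ∩ neighbours G u ∣     ≡⟨ cong ∣_∣ (∩-comm ⁅ u ⁆ (neighbours G u)) ⟩
      ∣ neighbours G u ∩ ⁅ u ⁆ ∣     ≡⟨ ∣∩⁅⁆∣ (neighbours G u) u ⟩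
      [ lookup (neighbours G u) u ]₁ ≡⟨ cong [_]₁ (lookup-∉ (adj-irrefl refl ∘ Equivalence.to (∈-neighbours G))) ⟩
      0                              ∎

  -- The coefficient of xⁿ yⁿ⁺² is positive, so some connected set has n = m vertices and is the
  -- whole vertex set.
  connected : Connected G ⊤
  connected =
    let _ , ≢0 = sum-map-≢0 (λ S → coeff (term G S) n (n + 2)) (subsets m) sum≢0
        _ , conn , ∣S∣≡n = coeff-term-≢0 G n (n + 2) ≢0
    in subst (Connected G) (∣p∣≡n⇒p≡⊤ (trans ∣S∣≡n (sym m≡n))) conn
    where
    open ≤-Reasoning
    1≤ : 1 ≤ coeff (cycleFormula n) n (n + 2)
    1≤ = begin
      1                                ≡⟨ mono-self 1 n (n + 2) ⟨
      mono 1 n (n + 2) n (n + 2)       ≤⟨ m≤n+m _ _ ⟩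
      _ + mono 1 n (n + 2) n (n + 2)   ≡⟨ coeff-cycleFormula n n (n + 2) (≤-trans (n≤1+n 2) 3≤n) ⟨
      coeff (cycleFormula n) n (n + 2) ∎
    sum≢0 : sum (map (λ S → coeff (term G S) n (n + 2)) (subsets m)) ≢ 0
    sum≢0 ≡0 = n≮0 (subst (1 ≤_) (trans (sym (da≈ n (n + 2))) (trans (coeff-da G n (n + 2)) ≡0)) 1≤)

  start : Fin m
  start = fromℕ< (subst (0 <_) (sym m≡n) (≤-trans (s≤s z≤n) 3≤n))

  ≅-cycle : G ≅ cycle n 3≤n
  ≅-cycle =
    let j , 3≤j , iso = Cover.≅-cycle G (TwoRegular.walk G degree start) connected
    in ≅-cycle-resize {G = G} 3≤j 3≤n iso m≡n

proposition17 : (n : ℕ) (3≤n : 3 ≤ n) (m : ℕ) .{{_ : NonZero m}} (G : Graph m) →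
    (G ≅ cycle n 3≤n) ⇔
    (da G ≈ₚ
    const n *ₚ x *ₚ y ^ₚ (n ∸ 2)
    +ₚ const n *ₚ y ^ₚ n *ₚ ∑[ 2 ⋯ n ∸ 1 ] (λ i → x ^ₚ i)
    +ₚ x ^ₚ n *ₚ y ^ₚ (n + 2))
proposition17 n 3≤n m G =
  mk⇔ (≅-cycle⇒da n 3≤n m G) (FromPolynomial.≅-cycle n 3≤n m G)
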